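{- Let $n,q,\alpha,\beta\ge 1$ be integers with $\gcd(\alpha,\beta)=1$, and let $C(n,q\alpha)\in\{a<z\}^n$ and $C(n,q\beta)\in\{b<z\}^n$ be two superimposable Christoffel words. Let $(x,y)$ be the unique integer solution of $$x\alpha+y\beta=n-2\alpha\beta(q-1)$$ with $1\le y\le\alpha$. Then the number of superimpositions of $C(n,q\alpha)$ and $C(n,q\beta)$ is (i) $xy$, if $x\le\beta$; (ii) $x\alpha+y\beta-\alpha\beta$, if $x>\beta$.
   Context: For coprime $s,t\in\{0,1,2,\dots\}$ and $n=s+t$, the Christoffel word over the ordered alphabet $\{a<z\}$ with $s$ occurrences of $a$ and $t$ occurrences of $z$ is $u=u[0]u[1]\cdots u[n-1]$ with $u[i]=a$ if $((i+1)t \bmod n)>(it\bmod n)$ and $u[i]=z$ otherwise. It is denoted $C(n,s)$; calling $C(n,s)$ a Christoffel word presupposes $\gcd(n,s)=1$. Over $\{b<z\}$ the definition is the same with $b$ in place of $a$. For a letter $c$ and a finite word $w$, $\gamma(cw)=wc$; $\gamma$ is a bijection on words of a given length, and $\gamma^k$ is defined for all $k\in\mathbb Z$. Let $u\in\{a,z\}^n$ and $v\in\{b,z\}^m$, let $A$ be the set of positions (indexed from $0$) of the letter $a$ in $u$ and $B$ the set of positions of the letter $b$ in $v$. The words $u,v$ are perfectly superimposable if $(A+n\mathbb Z)\cap(B+m\mathbb Z)=\emptyset$, and superimposable if there is $k\in\mathbb Z$ with $(A+n\mathbb Z)\cap(B-k+m\mathbb Z)=\emptyset$ (equivalently, $u$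 and $\gamma^k(v)$ are perfectly superimposable for some $k$). The number of superimpositions of two superimposable Christoffel words $C(n,s)$ and $C(n,t)$ of the same length $n$ is the number of $k\in\{0,1,\dots,n-1\}$ such that $C(n,s)$ and $\gamma^kC(n,t)$ are perfectly superimposable. -}

module Defs where

open import Data.Bool using (if_then_else_)
open import Data.Fin using (Fin; toℕ)
open import Data.Fin.Properties using (toℕ<n; toℕ-injective; any?)
open import Data.Integer using (ℤ; +_; _+_; _-_; _*_; ∣_∣; 0ℤ)
open import Data.Integer.Properties using (+-injective; i-j≡0⇒i≡j; ∣i∣≡0⇒i≡0; ∣m⊝n∣≤m⊔n; m-n≡m⊖n; abs-*)
open import Data.Integer.Tactic.RingSolver using (solve-∀)
open import Data.Nat using (ℕ; zero; suc; NonZero; _∸_; _%_; _<ᵇ_) renaming (_*_ to _*ℕ_; _<_ to _<ℕ_)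
open import Data.Nat.Divisibility using (_∣_; divides; ∣⇒≤)
open import Data.Nat.GeneralisedArithmetic using (fold)
open import Data.Nat.Properties using (<⇒≱; ≤-<-trans; ⊔-pres-<m)
open import Data.Product using (∃-syntax; _×_; _,_)
open import Data.Vec using (Vec; []; _∷_; _∷ʳ_; allFin; count; lookup; tabulate)
open import Level using (0ℓ)
open import Relation.Binary.Definitions using (DecidableEquality)
open import Relation.Binary.PropositionalEquality using (_≡_; refl; sym; trans; cong; subst)
open import Relation.Nullary using (Dec; yes; no; contradiction)
open import Relation.Nullary.Decidable using (map′; ¬?; _×-dec_)
open import Relation.Unary using (Pred; Empty; _∩_)

data AZ : Set where
  a z : AZ

data BZ : Set where
  b z : BZ

-- christoffelLetter c d n t i is the letter at position i of the Christoffel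
-- word of length n over {c < d} with n ∸ t occurrences of c and t of d.
-- For t = 0 coprimality forces n = 1, and the word with one c and no d is "c";
-- the comparison of residues modulo 1 would wrongly give "d" there, so this
-- case is separated.
christoffelLetter : {Σ : Set} → Σ → Σ → (n t : ℕ) → .{{NonZero n}} → ℕ → Σ
christoffelLetter c d n zero      i = c
christoffelLetter c d n t@(suc _) i =
  if ((i *ℕ t) % n) <ᵇ ((suc i *ℕ t) % n) then c else d

-- The word C(n,s) over {c < d}; meaningful when s ≤ n and gcd(n,s) = 1.
C : {Σ : Set} → Σ → Σ → (n s : ℕ) → .{{NonZero n}} → Vec Σ n
C c d n s = tabulate (λ i → christoffelLetter c d n (n ∸ s) (toℕ i))

γ : {Σ : Set} {n : ℕ} → Vec Σ n → Vec Σ n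
γ []      = []
γ (c ∷ w) = w ∷ʳ c

γ^ : {Σ : Set} {n : ℕ} → ℕ → Vec Σ n → Vec Σ n
γ^ k w = fold w γ k

Positions : {Σ : Set} {n : ℕ} → Σ → Vec Σ n → Pred ℤ 0ℓ
Positions c w p = ∃[ i ] (lookup w i ≡ c × p ≡ + toℕ i)

infixl 6 _⊕_ℤ _⊝_

-- X ⊕ n ℤ = { x + j n ∣ x ∈ X, j ∈ ℤ }
_⊕_ℤ : Pred ℤ 0ℓ → ℕ → Pred ℤ 0ℓ
(X ⊕ n ℤ) p = ∃[ x ] ∃[ j ] (X x × p ≡ x + j * + n)

-- X ⊝ k = { x - k ∣ x ∈ X }
_⊝_ : Pred ℤ 0ℓ → ℤ → Pred ℤ 0ℓ
(X ⊝ k) p = ∃[ x ] (X x × p ≡ x - k)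

PerfectlySuperimposable : {n m : ℕ} → Vec AZ n → Vec BZ m → Set
PerfectlySuperimposable {n} {m} u v =
  Empty ((Positions a u ⊕ n ℤ) ∩ (Positions b v ⊕ m ℤ))

Superimposable : {n m : ℕ} → Vec AZ n → Vec BZ m → Set
Superimposable {n} {m} u v =
  ∃[ k ] Empty ((Positions a u ⊕ n ℤ) ∩ ((Positions b v ⊝ k) ⊕ m ℤ))

_≟AZ_ : DecidableEquality AZ
a ≟AZ a = yes refl
a ≟AZ z = no λ ()
z ≟AZ a = no λ ()
z ≟AZ z = yes refl

_≟BZ_ : DecidableEquality BZ
b ≟BZ b = yes refl
b ≟BZ z = no λ ()
z ≟BZ b = no λ ()
z ≟BZ z = yes refl

∣∧<⇒≡0 : ∀ {n} m → n ∣ m → m <ℕ n → m ≡ 0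
∣∧<⇒≡0 zero    _   _   = refl
∣∧<⇒≡0 (suc m) n∣m m<n = contradiction (∣⇒≤ n∣m) (<⇒≱ m<n)

congruent⇒≡ : ∀ {n} (i i′ : Fin n) (j j′ : ℤ) →
              + toℕ i + j * + n ≡ + toℕ i′ + j′ * + n → i ≡ i′
congruent⇒≡ {n} i i′ j j′ eq =
  toℕ-injective (+-injective (i-j≡0⇒i≡j (+ toℕ i) (+ toℕ i′) (∣i∣≡0⇒i≡0 (∣∧<⇒≡0 _ n∣d d<n))))
  where
  rearrange : ∀ x y s → x - y ≡ (x + s) - (y + s)
  rearrange = solve-∀
  cancel : ∀ y s t m → (y + t * m) - (y + s * m) ≡ (t - s) * m
  cancel = solve-∀
  d≡ : + toℕ i - + toℕ i′ ≡ (j′ - j) * + n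
  d≡ = trans (rearrange (+ toℕ i) (+ toℕ i′) (j * + n))
         (trans (cong (_- (+ toℕ i′ + j * + n)) eq) (cancel (+ toℕ i′) j j′ (+ n)))
  n∣d : n ∣ ∣ + toℕ i - + toℕ i′ ∣
  n∣d = divides ∣ j′ - j ∣ (trans (cong ∣_∣ d≡) (abs-* (j′ - j) (+ n)))
  d<n : ∣ + toℕ i - + toℕ i′ ∣ <ℕ n
  d<n = subst (λ d → ∣ d ∣ <ℕ n) (sym (m-n≡m⊖n (toℕ i) (toℕ i′)))
          (≤-<-trans (∣m⊝n∣≤m⊔n (toℕ i) (toℕ i′)) (⊔-pres-<m (toℕ<n i) (toℕ<n i′)))

perfectlySuperimposable? : {n : ℕ} (u : Vec AZ n) (v : Vec BZ n) →
                           Dec (PerfectlySuperimposable u v)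
perfectlySuperimposable? {n} u v =
  map′ to from (¬? (any? λ i → (lookup u i ≟AZ a) ×-dec (lookup v i ≟BZ b)))
  where
  to : _ → PerfectlySuperimposable u v
  to ¬clash p ((_ , j , (i , ui≡a , refl) , p≡) , (_ , j′ , (i′ , vi′≡b , refl) , p≡′)) =
    ¬clash (i , ui≡a , subst (λ h → lookup v h ≡ b) (sym i≡i′) vi′≡b)
    where
    i≡i′ : i ≡ i′
    i≡i′ = congruent⇒≡ i i′ j j′ (trans (sym p≡) p≡′)
  from : PerfectlySuperimposable u v → _
  from ps (i , ui≡a , vi≡b) =
    ps (+ toℕ i) ( (+ toℕ i , 0ℤ , (i , ui≡a , refl) , x≡x+0*n (+ toℕ i) (+ n))
                 , (+ toℕ i , 0ℤ , (i , vi≡b , refl) , x≡x+0*n (+ toℕ i) (+ n)))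
    where
    x≡x+0*n : ∀ x m → x ≡ x + 0ℤ * m
    x≡x+0*n = solve-∀

numberOfSuperimpositions : {n : ℕ} → Vec AZ n → Vec BZ n → ℕ
numberOfSuperimpositions {n} u v =
  count (λ k → perfectlySuperimposable? u (γ^ (toℕ k) v)) (allFin n)

{-# OPTIONS --safe #-}

-- Modulo n, position i carries the first letter of C(n,s) iff −is mod n < s.
-- Multiplying by qαβ therefore turns "k is not a superimposition" into "some
-- residue depending bijectively on k is met by the sums βe + αe′ with
-- 0 ≤ e < qα, 0 ≤ e′ < qβ". These sums are the values βr + αh on the rectangle
-- 0 ≤ r < α, 0 ≤ h < M, where M = (2q−1)β. With X = x + 2β(q−1) the equation for
-- (x, y) reads n = βy + αX, so the pairs (r, h) with n ∣ βr + αh form the lattice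
-- spanned by (α, −β) and (y, X), for which the L-shaped region
-- [0,α) × [0,X) ∪ [0,y) × [X,X+β) is a fundamental domain. Its points are the
-- lowest nonnegative ones of their classes, so a residue is missed by the
-- rectangle exactly when its representative in the L-shape has h ≥ M; since
-- X + β = M + x, there are yx + (α−y)·max(x−β, 0) of those. If x were
-- negative the rectangle would contain the L-shape and nothing would be missed.

module Submission where

open import Defs
open import Data.Integer using (ℤ; +_; _+_; _-_; _*_; _≤_; _<_)
open import Data.Nat using (ℕ; NonZero) renaming (_*_ to _*ℕ_; _≤_ to _≤ℕ_)
open import Data.Nat.GCD using (gcd)
open import Data.Product using (_×_)
open import Relation.Binary.PropositionalEquality using (_≡_)

open import Data.Bool using (true; false; if_then_else_; T)
open import Data.Empty using (⊥)
open import Data.Fin as Fin using (Fin; toℕ; fromℕ<)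
open import Data.Fin.Properties using (toℕ-fromℕ<; fromℕ<-injective; toℕ-injective; toℕ<n)
open import Data.Integer using (-[1+_]; 0ℤ; 1ℤ; -_; +≤+; +<+; -≤+; _≤?_; _%ℕ_; _/ℕ_; ∣_∣)
open import Data.Integer.DivMod using (a≡a%ℕn+[a/ℕn]*n; n%ℕd<d)
open import Data.Integer.Divisibility.Signed
open import Data.Integer.Properties
open import Data.Integer.Tactic.RingSolver using (solve-∀)
open import Data.List as List using (List; []; _∷_; _++_; length; filter; cartesianProduct; applyUpTo; upTo)
open import Data.List.Membership.Propositional using (_∈_)
open import Data.List.Membership.Propositional.Properties
open import Data.List.Properties using (length-++; length-map; length-applyUpTo; length-upTo; length-++-sucʳ)
open import Data.List.Relation.Unary.All as All using ()
open import Data.List.Relation.Unary.AllPairs using ([]; _∷_)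
open import Data.List.Relation.Unary.Any using (here; there)
open import Data.List.Relation.Unary.Unique.Propositional using (Unique)
import Data.List.Relation.Unary.Unique.Propositional.Properties as Unique
open import Data.Nat as ℕ using (zero; suc; z≤n; s≤s; _∸_; _%_; _<ᵇ_)
open import Data.Nat.Coprimality using (gcd≡1⇒coprime; coprime-Bézout)
import Data.Nat.DivMod as ℕ
open import Data.Nat.GCD using (module Bézout)
import Data.Nat.Properties as ℕ
import Data.Nat.Tactic.RingSolver as ℕ-Solver
open import Data.Product using (∃-syntax; ∃₂; _,_; proj₁; proj₂)
open import Data.Sum using (inj₁; inj₂)
open import Data.Vec as Vec using (Vec; []; _∷_; _∷ʳ_; count; tabulate)
open import Data.Vec.Properties using (lookup∘tabulate; tabulate-cong)
open import Function using (_∘_; _⇔_; mk⇔; Equivalence; id; it)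
open import Relation.Binary.PropositionalEquality
open import Relation.Nullary
open import Relation.Unary using (Decidable)

open Equivalence

-- Certificates for integer equations and inequalities; inverses modulo n

infixl 6 _⊞_
infixl 7 _⊠_

-- The ring solver proves identities only. A hypothesis `u ≡ v` therefore enters as the multiple
-- `w * (u - v)` that turns the goal into an identity.
≡-from : ∀ {l r u v} w → u ≡ v → l - r ≡ w * (u - v) → l ≡ r
≡-from {l} {r} {u} w refl l-r≡ =
  i-j≡0⇒i≡j l r (trans l-r≡ (trans (cong (w *_) (+-inverseʳ u)) (*-zeroʳ w)))

-- Here `e` is the gap rewritten so that its sign is visible: `_⊞_` and `_⊠_` assemble the sign
-- proof along the shape of `e`, and the ring solver checks that `e` is the gap.
≤-from : ∀ {i j e} → 0ℤ ≤ e → e ≡ j - i → i ≤ j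
≤-from 0≤e refl = 0≤i-j⇒j≤i 0≤e

<-from : ∀ {i j e} → 0ℤ ≤ e → e ≡ j - i - 1ℤ → i < j
<-from {i} {j} 0≤e eq = suc[i]≤j⇒i<j (≤-from 0≤e (trans eq (lem i j)))
  where
  lem : ∀ i j → j - i - 1ℤ ≡ j - (1ℤ + i)
  lem = solve-∀

<⇒gap : ∀ {i j} → i < j → 0ℤ ≤ j - i - 1ℤ
<⇒gap {i} {j} i<j = subst (0ℤ ≤_) (lem i j) (i≤j⇒0≤j-i (i<j⇒suc[i]≤j i<j))
  where
  lem : ∀ i j → j - (1ℤ + i) ≡ j - i - 1ℤ
  lem = solve-∀

0≤+ : ∀ {n} → 0ℤ ≤ + n
0≤+ = +≤+ z≤n

_⊞_ : ∀ {i j} → 0ℤ ≤ i → 0ℤ ≤ j → 0ℤ ≤ i + j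
_⊞_ = +-mono-≤

_⊠_ : ∀ {i j} → 0ℤ ≤ i → 0ℤ ≤ j → 0ℤ ≤ i * j
_⊠_ {+ m} {+ n} _ _ = subst (0ℤ ≤_) (pos-* m n) 0≤+

cast< : ∀ {m n} → m ℕ.< n → 0ℤ ≤ + n - + m - 1ℤ
cast< m<n = <⇒gap (+<+ m<n)

-- Coprimality is stored as an explicit inverse, because later witnesses (positions, rotations,
-- starting heights) are computed from it.
Invertible : ℕ → ℤ → Set
Invertible n m = ∃[ w ] + n ∣ w * m - 1ℤ

cancel : ∀ {n m} → Invertible n m → ∀ k → + n ∣ m * k → + n ∣ k
cancel {n} {m} (w , n∣wm-1) k n∣ak =
  subst (+ n ∣_) (lem w m k) (∣m∣n⇒∣m-n (∣n⇒∣m*n w n∣ak) (∣m⇒∣m*n k n∣wm-1))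
  where
  lem : ∀ w m k → w * (m * k) - (w * m - 1ℤ) * k ≡ k
  lem = solve-∀

-- The L-shaped fundamental domain

value : ℕ → ℕ → ℕ → ℤ → ℤ
value α β r h = + β * + r + + α * h

module Staircase
  (n α β y : ℕ) (X : ℤ) .{{_ : NonZero n}} .{{_ : NonZero α}}
  (n≡ : + n ≡ + β * + y + + α * X) (y≤α : y ℕ.≤ α)
  where

  -- Only the upper boundary of the L-shape. Nonnegativity of the height is carried separately, and
  -- heights are integers because climbing starts below 0.
  UnderStep : ℕ → ℤ → Set
  UnderStep r h = (r ℕ.< y → h < X + + β) × (y ℕ.≤ r → h < X)

  value-shift : ∀ r h → value α β r h + + n ≡ + β * (+ r + + y) + + α * (h + X)
  value-shift r h = trans (cong (λ m → value α β r h + m) n≡) (lem (+ α) (+ β) (+ r) (+ y) h X)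
    where
    lem : ∀ α β r y h X → β * r + α * h + (β * y + α * X) ≡ β * (r + y) + α * (h + X)
    lem = solve-∀

  -- Adding n moves a point by (y, X). If this leaves the rows below α, the value-preserving vector
  -- (-α, β) brings it back, to a row below y, where the boundary is higher by exactly the β gained.
  -- Starting from `h < 0`, the point stays under the boundary in both cases.
  raise : ∀ r h → r ℕ.< α → h < 0ℤ →
    ∃₂ λ r′ h′ → r′ ℕ.< α × UnderStep r′ h′ × value α β r′ h′ ≡ value α β r h + + n
  raise r h r<α h<0 with r ℕ.+ y ℕ.<? α
  ... | yes r+y<α =
    r ℕ.+ y , h + X , r+y<α ,
    ((λ r+y<y → contradiction r+y<y (ℕ.≤⇒≯ (ℕ.m≤n+m y r))) ,
     (λ _ → subst (h + X <_) (+-identityˡ X) (+-monoˡ-< X h<0))) ,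
    sym (value-shift r h)
  ... | no r+y≮α with ℕ.m≤n⇒∃[o]m+o≡n (ℕ.≮⇒≥ r+y≮α)
  ... | r′ , α+r′≡r+y =
    r′ , h + X + + β , ℕ.<-≤-trans r′<y y≤α ,
    ((λ _ → +-monoˡ-< (+ β) (subst (h + X <_) (+-identityˡ X) (+-monoˡ-< X h<0))) ,
     (λ y≤r′ → contradiction r′<y (ℕ.≤⇒≯ y≤r′))) ,
    sym (trans (value-shift r h)
      (trans (cong (λ m → + β * m + + α * (h + X)) (cong +_ (sym α+r′≡r+y)))
             (lem (+ α) (+ β) (+ r′) (h + X))))
    where
    lem : ∀ α β r h → β * (α + r) + α * h ≡ β * r + α * (h + β)
    lem = solve-∀
    r′<y : r′ ℕ.< y
    r′<y = ℕ.+-cancelˡ-< α r′ y (subst (ℕ._< α ℕ.+ y) (sym α+r′≡r+y) (ℕ.+-monoˡ-< y r<α))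

  -- Raising is repeated until the height is nonnegative. A point with negative height in a row
  -- below α has value less than αβ, and each raise adds n ≥ 1, so fuel covering the deficit to αβ
  -- cannot run out first.
  climb : ∀ fuel r h → r ℕ.< α → h < 0ℤ → + α * + β ≤ value α β r h + + fuel →
    ∃₂ λ r′ h′ → r′ ℕ.< α × 0ℤ ≤ h′ × UnderStep r′ h′ × + n ∣ value α β r′ h′ - value α β r h
  climb zero r h r<α h<0 αβ≤ = contradiction αβ≤ (<⇒≱ below)
    where
    lem : ∀ α β r h → β * (α - r - 1ℤ) + β + α * (0ℤ - h - 1ℤ) + ((α - r - 1ℤ) + r)
          ≡ α * β - (β * r + α * h + 0ℤ) - 1ℤ
    lem = solve-∀
    below : value α β r h + 0ℤ < + α * + β
    below = <-from (0≤+ {β} ⊠ cast< r<α ⊞ 0≤+ {β} ⊞ 0≤+ {α} ⊠ <⇒gap h<0 ⊞ (cast< r<α ⊞ 0≤+ {r}))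
                   (lem (+ α) (+ β) (+ r) h)
  climb (suc fuel) r h r<α h<0 αβ≤ with raise r h r<α h<0
  ... | r′ , h′ , r′<α , under , shift with 0ℤ ≤? h′
  ...   | yes 0≤h′ = r′ , h′ , r′<α , 0≤h′ , under ,
          divides 1ℤ (trans (cong (_- value α β r h) shift) (lem (value α β r h) (+ n)))
    where
    lem : ∀ v n → v + n - v ≡ 1ℤ * n
    lem = solve-∀
  ...   | no 0≰h′ with climb fuel r′ h′ r′<α (≰⇒> 0≰h′) enough
    where
    lem : ∀ v f n c → v + (1ℤ + f) - c + (n - 0ℤ - 1ℤ) ≡ v + n + f - c
    lem = solve-∀
    enough : + α * + β ≤ value α β r′ h′ + + fuel
    enough = subst (λ v → + α * + β ≤ v + + fuel) (sym shift)
      (≤-from (i≤j⇒0≤j-i αβ≤ ⊞ cast< (ℕ.>-nonZero⁻¹ n)) (lem (value α β r h) (+ fuel) (+ n) (+ α * + β)))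
  ... | r″ , h″ , r″<α , 0≤h″ , under″ , n∣ = r″ , h″ , r″<α , 0≤h″ , under″ ,
          subst (+ n ∣_) (lem (value α β r″ h″) (value α β r h) (+ n))
            (∣m∣n⇒∣m+n (subst (λ v → + n ∣ value α β r″ h″ - v) shift n∣) ∣-refl)
    where
    lem : ∀ u v n → u - (v + n) + n ≡ u - v
    lem = solve-∀

  module _ (invβ : Invertible α (+ β)) (0≤X : 0ℤ ≤ X) where

    -- Along the class v, v ± n, v ± 2n, … the height increases, by at least X per
    -- step, and by X + β on entering a row below y.
    lowest : ∀ {r h r′ h′} → r ℕ.< α → r′ ℕ.< α → UnderStep r h → 0ℤ ≤ h′ →
             + n ∣ value α β r′ h′ - value α β r h → h ≤ h′
    lowest {r} {h} {r′} {h′} r<α r′<α (under , under′) 0≤h′ (divides j eq)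
      -- Reading the equation modulo α and cancelling β gives d with (r′, h′) = (r, h) + j (y, X) +
      -- d (α, -β).
      with cancel {m = + β} invβ (+ r′ - + r - j * + y)
             (divides (j * X + h - h′) (≡-from 1ℤ (trans eq (cong (j *_) n≡))
               (move (+ α) (+ β) (+ r) (+ r′) h h′ (+ y) X j)))
      where
      move : ∀ α β r r′ h h′ y X j → β * (r′ - r - j * y) - (j * X + h - h′) * α ≡
        1ℤ * (β * r′ + α * h′ - (β * r + α * h) - j * (β * y + α * X))
      move = solve-∀
    ... | divides d d≡ = go j d≡ h′≡
      where
      h′≡ : h′ ≡ h + j * X - + β * d
      h′≡ = *-cancelˡ-≡ (+ α) h′ (h + j * X - + β * d) (≡-from 1ℤ
        (cong₂ (λ u v → u - + β * v) (trans eq (cong (j *_) n≡)) d≡)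
        (split (+ α) (+ β) (+ r) (+ r′) h h′ (+ y) X j d))
        where
        split : ∀ α β r r′ h h′ y X j d → α * h′ - α * (h + j * X - β * d) ≡
          1ℤ * (β * r′ + α * h′ - (β * r + α * h) - β * (r′ - r - j * y)
                - (j * (β * y + α * X) - β * (d * α)))
        split = solve-∀
      go : ∀ j → + r′ - + r - j * + y ≡ d * + α → h′ ≡ h + j * X - + β * d → h ≤ h′
      -- For j ≥ 0 the row bound r′ < α forces d ≤ 0, so neither lattice vector lowers the height.
      go (+ i) d≡ refl = ≤-from (0≤+ {i} ⊠ 0≤X ⊞ 0≤+ {β} ⊠ <⇒gap d<1)
                                (lem₂ h (+ i) X (+ β) d)
        where
        lem₁ : ∀ α r r′ i y → (α - r′ - 1ℤ) + r + i * y ≡ 1ℤ * α - (r′ - r - i * y) - 1ℤ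
        lem₁ = solve-∀
        lem₂ : ∀ h i X β d → i * X + β * (1ℤ - d - 1ℤ) ≡ h + i * X - β * d - h
        lem₂ = solve-∀
        d<1 : d < 1ℤ
        d<1 = *-cancelʳ-<-nonNeg (+ α) (subst (_< 1ℤ * + α) d≡
          (<-from (cast< r′<α ⊞ 0≤+ {r} ⊞ 0≤+ {i} ⊠ 0≤+ {y}) (lem₁ (+ α) (+ r) (+ r′) (+ i) (+ y))))
      -- For j < 0 the height h′ would be negative: if r < y then d ≥ 1 and at least X + β is lost
      -- from h < X + β; otherwise d ≥ 0 and at least X is lost from h < X.
      go -[1+ i ] d≡ refl with r ℕ.<? y
      ... | yes r<y = contradiction 0≤h′ (<⇒≱ (<-from
          (<⇒gap (under r<y) ⊞ 0≤+ {i} ⊠ 0≤X ⊞ 0≤+ {β} ⊠ <⇒gap 0<d)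
          (lem₂ h (+ i) X (+ β) d)))
        where
        lem₁ : ∀ r r′ i y → (y - r - 1ℤ) + r′ + i * y ≡ r′ - r - (- (1ℤ + i)) * y - 0ℤ - 1ℤ
        lem₁ = solve-∀
        lem₂ : ∀ h i X β d → (X + β - h - 1ℤ) + i * X + β * (d - 0ℤ - 1ℤ)
             ≡ 0ℤ - (h + (- (1ℤ + i)) * X - β * d) - 1ℤ
        lem₂ = solve-∀
        0<d : 0ℤ < d
        0<d = *-cancelʳ-<-nonNeg (+ α) (subst (0ℤ <_) d≡
          (<-from (cast< r<y ⊞ 0≤+ {r′} ⊞ 0≤+ {i} ⊠ 0≤+ {y}) (lem₁ (+ r) (+ r′) (+ i) (+ y))))
      ... | no r≮y = contradiction 0≤h′ (<⇒≱ (<-from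
          (<⇒gap (under′ (ℕ.≮⇒≥ r≮y)) ⊞ 0≤+ {i} ⊠ 0≤X ⊞ 0≤+ {β} ⊠ <⇒gap -1<d)
          (lem₂ h (+ i) X (+ β) d)))
        where
        lem₁ : ∀ α r r′ i y → (α - r - 1ℤ) + r′ + (1ℤ + i) * y
             ≡ r′ - r - (- (1ℤ + i)) * y - (- 1ℤ) * α - 1ℤ
        lem₁ = solve-∀
        lem₂ : ∀ h i X β d → (X - h - 1ℤ) + i * X + β * (d - (- 1ℤ) - 1ℤ)
             ≡ 0ℤ - (h + (- (1ℤ + i)) * X - β * d) - 1ℤ
        lem₂ = solve-∀
        -1<d : - 1ℤ < d
        -1<d = *-cancelʳ-<-nonNeg (+ α) (subst ((- 1ℤ) * + α <_) d≡
          (<-from (cast< r<α ⊞ 0≤+ {r′} ⊞ 0≤+ {suc i} ⊠ 0≤+ {y}) (lem₁ (+ α) (+ r) (+ r′) (+ i) (+ y))))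

-- Rotations of words given by periodic functions

tabulate-∷ʳ : ∀ {A : Set} (f : ℕ → A) m →
  tabulate {n = m} (f ∘ toℕ) ∷ʳ f m ≡ tabulate {n = suc m} (f ∘ toℕ)
tabulate-∷ʳ f zero    = refl
tabulate-∷ʳ f (suc m) = cong (f 0 ∷_) (tabulate-∷ʳ (f ∘ suc) m)

γ-tabulate : ∀ {A : Set} n (f : ℕ → A) → f 0 ≡ f n →
  γ (tabulate {n = n} (f ∘ toℕ)) ≡ tabulate (f ∘ suc ∘ toℕ)
γ-tabulate zero    f f0≡fn = refl
γ-tabulate (suc m) f f0≡fn =
  trans (cong (tabulate (f ∘ suc ∘ toℕ) ∷ʳ_) f0≡fn) (tabulate-∷ʳ (f ∘ suc) m)

-- Each rotation moves the letter at index k to the end, where by periodicity it is also the letter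
-- at index k + n.
γ^-tabulate : ∀ {A : Set} n (f : ℕ → A) → (∀ i → f i ≡ f (n ℕ.+ i)) → ∀ k →
  γ^ k (tabulate {n = n} (f ∘ toℕ)) ≡ tabulate (λ i → f (k ℕ.+ toℕ i))
γ^-tabulate n f periodic zero    = refl
γ^-tabulate n f periodic (suc k) = begin
  γ (γ^ k (tabulate (f ∘ toℕ)))             ≡⟨ cong γ (γ^-tabulate n f periodic k) ⟩
  γ (tabulate (λ i → f (k ℕ.+ toℕ i)))      ≡⟨ γ-tabulate n (λ i → f (k ℕ.+ i)) wrap ⟩
  tabulate (λ i → f (k ℕ.+ suc (toℕ i)))    ≡⟨ tabulate-cong (λ i → cong f (ℕ.+-suc k (toℕ i))) ⟩
  tabulate (λ i → f (suc k ℕ.+ toℕ i))      ∎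
  where
  open ≡-Reasoning
  wrap : f (k ℕ.+ 0) ≡ f (k ℕ.+ n)
  wrap = trans (cong f (ℕ.+-identityʳ k)) (trans (periodic k) (cong f (ℕ.+-comm n k)))

-- Christoffel letters and superimposition as congruences modulo n

residue-unique : ∀ {n i j} → i ℕ.< n → j ℕ.< n → + n ∣ + i - + j → i ≡ j
residue-unique {n} {i} {j} i<n j<n (divides d i-j≡dn) =
  fromℕ<-injective i j i<n j<n (congruent⇒≡ (fromℕ< i<n) (fromℕ< j<n) 0ℤ d eq)
  where
  lem : ∀ i j n → i + 0ℤ * n ≡ j + (i - j)
  lem = solve-∀
  eq : + toℕ (fromℕ< i<n) + 0ℤ * + n ≡ + toℕ (fromℕ< j<n) + d * + n
  eq rewrite toℕ-fromℕ< i<n | toℕ-fromℕ< j<n =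
    trans (lem (+ i) (+ j) (+ n)) (cong (λ m → + j + m) i-j≡dn)

module _ (n s : ℕ) .{{_ : NonZero n}} (s≤n : s ℕ.≤ n) where

  -- Modulo n the factor n - s is -s, so this residue is the one cancelling ms.
  ∣-residue : ∀ m → + n ∣ + m * + s + + ((m ℕ.* (n ∸ s)) % n)
  ∣-residue m = divides (+ m - + Q) (lem (+ m) (+ s) (+ ρ) (+ (n ∸ s)) (+ Q) n≡ m*t≡)
    where
    ρ = (m ℕ.* (n ∸ s)) % n
    Q = (m ℕ.* (n ∸ s)) ℕ./ n
    n≡ : + s + + (n ∸ s) ≡ + n
    n≡ = cong +_ (ℕ.m+[n∸m]≡n s≤n)
    m*t≡ : + m * + (n ∸ s) ≡ + ρ + + Q * + n
    m*t≡ = trans (sym (pos-* m (n ∸ s)))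
      (trans (cong +_ (ℕ.m≡m%n+[m/n]*n (m ℕ.* (n ∸ s)) n)) (cong (λ k → + ρ + k) (pos-* Q n)))
    lem : ∀ m s ρ t Q {n} → s + t ≡ n → m * t ≡ ρ + Q * n → m * s + ρ ≡ (m - Q) * n
    lem m s ρ t Q refl eq = ≡-from (- 1ℤ) eq (move m s ρ t Q)
      where
      move : ∀ m s ρ t Q → m * s + ρ - (m - Q) * (s + t) ≡ (- 1ℤ) * (m * t - (ρ + Q * (s + t)))
      move = solve-∀

  residue-≡ : ∀ m {ρ} → ρ ℕ.< n → + n ∣ + m * + s + + ρ → (m ℕ.* (n ∸ s)) % n ≡ ρ
  residue-≡ m {ρ} ρ<n n∣ = residue-unique (ℕ.m%n<n _ n) ρ<n
    (subst (+ n ∣_) (lem (+ m * + s) _ (+ ρ)) (∣m∣n⇒∣m-n (∣-residue m) n∣))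
    where
    lem : ∀ a b c → a + b - (a + c) ≡ b - c
    lem = solve-∀

module _ {Σ : Set} (c d : Σ) (n s : ℕ) .{{_ : NonZero n}} where

  letter : ℕ → Σ
  letter = christoffelLetter c d n (n ∸ s)

  letter-periodic : ∀ i → letter i ≡ letter (n ℕ.+ i)
  letter-periodic i with n ∸ s
  ... | zero  = refl
  ... | suc t = cong₂ (λ j k → if j <ᵇ k then c else d) (shift i)
      (trans (shift (suc i)) (cong (λ j → (j ℕ.* suc t) % n) (ℕ.+-suc n i)))
    where
    shift : ∀ i → (i ℕ.* suc t) % n ≡ ((n ℕ.+ i) ℕ.* suc t) % n
    shift i = sym (trans (cong (_% n) (trans (ℕ.*-distribʳ-+ (suc t) n i)
      (trans (ℕ.+-comm (n ℕ.* suc t) _) (cong (i ℕ.* suc t ℕ.+_) (ℕ.*-comm n (suc t))))))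
      (ℕ.[m+kn]%n≡m%n (i ℕ.* suc t) (suc t) n))

module _ {Σ : Set} (c d : Σ) (c≢d : c ≢ d) (n s : ℕ) .{{_ : NonZero n}} .{{_ : NonZero s}} (s≤n : s ℕ.≤ n) where

  if-<ᵇ-yes : ∀ {i j} → i ℕ.< j → (if i <ᵇ j then c else d) ≡ c
  if-<ᵇ-yes {i} {j} i<j with i <ᵇ j | ℕ.<⇒<ᵇ i<j
  ... | true | _ = refl

  if-<ᵇ-c : ∀ {i j} → (if i <ᵇ j then c else d) ≡ c → i ℕ.< j
  if-<ᵇ-c {i} {j} eq with i <ᵇ j in i<ᵇj
  ... | true  = ℕ.<ᵇ⇒< i j (subst T (sym i<ᵇj) _)
  ... | false = contradiction (sym eq) c≢d

  -- Passing to the next position adds t to the residue ρ. If ρ < s = n - t there is no wrap-around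
  -- and the residue grows; otherwise it becomes ρ - s, which is smaller.
  letter≡c : ∀ t → t ℕ.+ s ≡ n → ∀ i → christoffelLetter c d n t i ≡ c ⇔ (i ℕ.* t) % n ℕ.< s
  -- In the separately defined case t = 0 every letter is `c`, in agreement with the residue 0 < s.
  letter≡c zero       t+s≡n i = mk⇔
    (λ _ → ℕ.≤-<-trans
      (ℕ.≤-reflexive (trans (cong (_% n) (ℕ.*-zeroʳ i)) (ℕ.m<n⇒m%n≡m (ℕ.>-nonZero⁻¹ n))))
      (ℕ.>-nonZero⁻¹ s))
    (λ _ → refl)
  letter≡c t@(suc t′) t+s≡n i = mk⇔
    (λ eq → ℕ.≰⇒> λ s≤ρ → ℕ.<-asym (if-<ᵇ-c eq) (wraps s≤ρ))
    (λ ρ<s → if-<ᵇ-yes (stays ρ<s))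
    where
    ρ = (i ℕ.* t) % n
    next≡ : (suc i ℕ.* t) % n ≡ (t ℕ.+ ρ) % n
    next≡ = trans (ℕ.%-distribˡ-+ t (i ℕ.* t) n)
      (trans (cong (λ k → (t % n ℕ.+ k) % n) (sym (ℕ.m%n%n≡m%n (i ℕ.* t) n))) (sym (ℕ.%-distribˡ-+ t ρ n)))
    stays : ρ ℕ.< s → ρ ℕ.< (suc i ℕ.* t) % n
    stays ρ<s = subst (ρ ℕ.<_)
      (sym (trans next≡ (ℕ.m<n⇒m%n≡m (subst (t ℕ.+ ρ ℕ.<_) t+s≡n (ℕ.+-monoʳ-< t ρ<s)))))
      (ℕ.m<n+m ρ ℕ.z<s)
    wraps : s ℕ.≤ ρ → (suc i ℕ.* t) % n ℕ.< ρ
    wraps s≤ρ with ℕ.m≤n⇒∃[o]m+o≡n s≤ρ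
    ... | o , s+o≡ρ = subst (ℕ._< ρ) (sym next≡o) (subst (o ℕ.<_) s+o≡ρ (ℕ.m<n+m o (ℕ.>-nonZero⁻¹ s)))
      where
      next≡o : (suc i ℕ.* t) % n ≡ o
      next≡o = trans next≡ (trans (cong (_% n)
        (trans (cong (t ℕ.+_) (sym s+o≡ρ)) (trans (sym (ℕ.+-assoc t s o)) (trans (cong (ℕ._+ o) t+s≡n) (ℕ.+-comm n o)))))
        (trans (ℕ.[m+n]%n≡m%n o n)
          (ℕ.m<n⇒m%n≡m (ℕ.≤-<-trans (subst (o ℕ.≤_) s+o≡ρ (ℕ.m≤n+m o s)) (ℕ.m%n<n (i ℕ.* t) n)))))

  positions-C : ∀ k p → (Positions c (tabulate {n = n} (λ i → letter c d n s (k ℕ.+ toℕ i))) ⊕ n ℤ) p ⇔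
    (∃[ ρ ] ρ ℕ.< s × + n ∣ (p + + k) * + s + + ρ)
  positions-C k p = mk⇔ fwd bwd
    where
    t+s≡n : n ∸ s ℕ.+ s ≡ n
    t+s≡n = ℕ.m∸n+n≡m s≤n
    fwd : (Positions c (tabulate {n = n} (λ i → letter c d n s (k ℕ.+ toℕ i))) ⊕ n ℤ) p → _
    fwd (_ , j , (i , eq , refl) , refl) =
      ((k ℕ.+ toℕ i) ℕ.* (n ∸ s)) % n ,
      to (letter≡c (n ∸ s) t+s≡n (k ℕ.+ toℕ i)) (trans (sym (lookup∘tabulate _ i)) eq) ,
      subst (+ n ∣_) (lem (+ k) (+ toℕ i) (+ s) (+ n) j _)
        (∣m∣n⇒∣m+n (∣-residue n s s≤n (k ℕ.+ toℕ i)) (∣n⇒∣m*n (j * + s) ∣-refl))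
      where
      lem : ∀ k i s n j ρ → (k + i) * s + ρ + j * s * n ≡ (i + j * n + k) * s + ρ
      lem = solve-∀
    bwd : (∃[ ρ ] ρ ℕ.< s × + n ∣ (p + + k) * + s + + ρ) →
          (Positions c (tabulate {n = n} (λ i → letter c d n s (k ℕ.+ toℕ i))) ⊕ n ℤ) p
    -- The index is p mod n. Since ρ < s ≤ n, the congruence determines ρ as the residue belonging
    -- to that index.
    bwd (ρ , ρ<s , n∣) = + toℕ i , p /ℕ n , (i , trans (lookup∘tabulate _ i) letter≡ , refl) , p≡
      where
      i = fromℕ< (n%ℕd<d p n)
      p≡ : p ≡ + toℕ i + (p /ℕ n) * + n
      p≡ = trans (a≡a%ℕn+[a/ℕn]*n p n) (cong (λ j → + j + (p /ℕ n) * + n) (sym (toℕ-fromℕ< (n%ℕd<d p n))))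
      lem : ∀ k i s n j ρ → (i + j * n + k) * s + ρ - j * s * n ≡ (k + i) * s + ρ
      lem = solve-∀
      letter≡ : letter c d n s (k ℕ.+ toℕ i) ≡ c
      letter≡ = from (letter≡c (n ∸ s) t+s≡n (k ℕ.+ toℕ i)) (subst (ℕ._< s)
        (sym (residue-≡ n s s≤n (k ℕ.+ toℕ i) (ℕ.<-≤-trans ρ<s s≤n)
          (subst (+ n ∣_) (lem (+ k) (+ toℕ i) (+ s) (+ n) (p /ℕ n) (+ ρ))
            (∣m∣n⇒∣m-n (subst (λ p → + n ∣ (p + + k) * + s + + ρ) p≡ n∣)
                       (∣n⇒∣m*n ((p /ℕ n) * + s) ∣-refl))))) ρ<s)

-- p lies in A + nℤ iff ps + ρ ≡ 0 (mod n) for some 0 ≤ ρ < s, and likewise for B.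
Avoid : ℕ → ℕ → ℕ → ℤ → Set
Avoid n s s′ k = ∀ p ρ ρ′ → ρ ℕ.< s → ρ′ ℕ.< s′ →
  + n ∣ p * + s + + ρ → + n ∣ (p + k) * + s′ + + ρ′ → ⊥

module _ (n s s′ : ℕ) .{{_ : NonZero n}} .{{_ : NonZero s}} .{{_ : NonZero s′}}
         (s≤n : s ℕ.≤ n) (s′≤n : s′ ℕ.≤ n) where

  private
    a≢z : AZ.a ≢ AZ.z
    a≢z ()
    b≢z : BZ.b ≢ BZ.z
    b≢z ()
    unshift : ∀ {m s ρ} p → + m ∣ p * s + ρ → + m ∣ (p + + 0) * s + ρ
    unshift {m} {s} {ρ} p = subst (λ p → + m ∣ p * s + ρ) (sym (+-identityʳ p))
    shift : ∀ {m s ρ} p → + m ∣ (p + + 0) * s + ρ → + m ∣ p * s + ρ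
    shift {m} {s} {ρ} p = subst (λ p → + m ∣ p * s + ρ) (+-identityʳ p)

  -- The unrotated first word is the instance 0 of `positions-C`; `shift` and `unshift` absorb the
  -- resulting `p + + 0`.
  perfectlySuperimposable⇔Avoid : ∀ k →
    PerfectlySuperimposable (C a z n s) (γ^ k (C b z n s′)) ⇔ Avoid n s s′ (+ k)
  perfectlySuperimposable⇔Avoid k
    rewrite γ^-tabulate n (letter b z n s′) (letter-periodic b z n s′) k = mk⇔
      (λ empty p ρ ρ′ ρ<s ρ′<s′ n∣ n∣′ → empty p
        ( from (positions-C a z a≢z n s s≤n 0 p) (ρ , ρ<s , unshift p n∣)
        , from (positions-C b z b≢z n s′ s′≤n k p) (ρ′ , ρ′<s′ , n∣′)))
      (λ avoid p (∈A , ∈B) →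
        let ρ , ρ<s , n∣ = to (positions-C a z a≢z n s s≤n 0 p) ∈A
            ρ′ , ρ′<s′ , n∣′ = to (positions-C b z b≢z n s′ s′≤n k p) ∈B
        in avoid p ρ ρ′ ρ<s ρ′<s′ (shift p n∣) n∣′)

  -- The shift is an arbitrary integer here, so the second word is left unrotated and its congruence
  -- is read at p + k.
  superimposable⇒Avoid : Superimposable (C a z n s) (C b z n s′) → ∃[ k ] Avoid n s s′ k
  superimposable⇒Avoid (k , empty) = k , λ p ρ ρ′ ρ<s ρ′<s′ n∣ n∣′ →
    let x , j , ∈B , p+k≡ = from (positions-C b z b≢z n s′ s′≤n 0 (p + k)) (ρ′ , ρ′<s′ , unshift (p + k) n∣′)
    in empty p
      ( from (positions-C a z a≢z n s s≤n 0 p) (ρ , ρ<s , unshift p n∣)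
      , x - k , j , (x , ∈B , refl) , ≡-from 1ℤ p+k≡ (move p k x (j * + n)))
    where
    move : ∀ p k x m → p - (x - k + m) ≡ 1ℤ * (p + k - (x + m))
    move = solve-∀

-- Counting with duplicate-free lists

length-cartesianProduct : ∀ {A B : Set} (xs : List A) (ys : List B) →
  length (cartesianProduct xs ys) ≡ length xs ℕ.* length ys
length-cartesianProduct []       ys = refl
length-cartesianProduct (x ∷ xs) ys = trans (length-++ (List.map (x ,_) ys))
  (cong₂ ℕ._+_ (length-map (x ,_) ys) (length-cartesianProduct xs ys))

-- A pigeonhole principle for relations, so that one relation can be used in both directions. The
-- partner of the head is deleted from `ys`; by injectivity no later element has lost its own
-- partner.
length-≤ : ∀ {A B : Set} (R : A → B → Set) {xs ys} → Unique xs →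
  (∀ {x} → x ∈ xs → ∃[ y ] y ∈ ys × R x y) →
  (∀ {x x′ y} → x ∈ xs → x′ ∈ xs → R x y → R x′ y → x ≡ x′) →
  length xs ℕ.≤ length ys
length-≤ R {[]}     {ys} _            total inj = z≤n
length-≤ R {x ∷ xs} {ys} (x∉xs ∷ uniq) total inj with total (here refl)
... | y , y∈ys , Rxy with ∈-∃++ y∈ys
... | as , bs , refl = ℕ.≤-trans (s≤s (length-≤ R uniq total′ (λ i j → inj (there i) (there j))))
                                 (ℕ.≤-reflexive (sym (length-++-sucʳ as y bs)))
  where
  total′ : ∀ {x′} → x′ ∈ xs → ∃[ y′ ] y′ ∈ as ++ bs × R x′ y′
  total′ {x′} x′∈xs with total (there x′∈xs)
  ... | y′ , y′∈ , Rx′y′ with ∈-++⁻ as y′∈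
  ... | inj₁ ∈as         = y′ , ∈-++⁺ˡ ∈as , Rx′y′
  ... | inj₂ (there ∈bs) = y′ , ∈-++⁺ʳ as ∈bs , Rx′y′
  ... | inj₂ (here refl) =
    contradiction (inj (here refl) (there x′∈xs) Rxy Rx′y′) (All.lookup x∉xs x′∈xs)

count-tabulate : ∀ {A : Set} {P : A → Set} (P? : Decidable P) {n} (f : Fin n → A) →
  count P? (Vec.tabulate f) ≡ length (filter P? (List.tabulate f))
count-tabulate P? {zero}  f = refl
count-tabulate P? {suc n} f with does (P? (f Fin.zero))
... | true  = cong suc (count-tabulate P? (f ∘ Fin.suc))
... | false = count-tabulate P? (f ∘ Fin.suc)

-- Inverses from Bézout identities

gcd≡1⇒invertible : ∀ n m → gcd n m ≡ 1 → Invertible n (+ m)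
gcd≡1⇒invertible n m gcd≡1 with coprime-Bézout (gcd≡1⇒coprime gcd≡1)
... | Bézout.+- x y 1+ym≡xn = - + y , divides (- + x) (≡-from (- 1ℤ)
        (trans (cong (λ i → 1ℤ + i) (sym (pos-* y m))) (trans (cong +_ 1+ym≡xn) (pos-* x n)))
        (move (+ y) (+ m) (+ x) (+ n)))
  where
  move : ∀ y m x n → (- y) * m - 1ℤ - (- x) * n ≡ (- 1ℤ) * (1ℤ + y * m - x * n)
  move = solve-∀
... | Bézout.-+ x y 1+xn≡ym = + y , divides (+ x) (≡-from (- 1ℤ)
        (trans (cong (λ i → 1ℤ + i) (sym (pos-* x n))) (trans (cong +_ 1+xn≡ym) (pos-* y m)))
        (move (+ y) (+ m) (+ x) (+ n)))
  where
  move : ∀ y m x n → y * m - 1ℤ - x * n ≡ (- 1ℤ) * (1ℤ + x * n - y * m)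
  move = solve-∀

invertible-factorʳ : ∀ {n} q m → Invertible n (+ (q ℕ.* m)) → Invertible n (+ m)
invertible-factorʳ {n} q m (w , n∣) = w * + q ,
  subst (λ m → + n ∣ m - 1ℤ) (trans (cong (w *_) (pos-* q m)) (sym (*-assoc w (+ q) (+ m)))) n∣

i≤+∣i∣ : ∀ i → i ≤ + ∣ i ∣
i≤+∣i∣ (+ n)    = ≤-refl
i≤+∣i∣ -[1+ n ] = -≤+

-- Superimpositions as residues missed by the rectangle

module Superimposition
  (n p α β : ℕ) .{{_ : NonZero n}} .{{_ : NonZero α}} .{{_ : NonZero β}}
  (s≤n : suc p ℕ.* α ℕ.≤ n) (s′≤n : suc p ℕ.* β ℕ.≤ n)
  (invs : Invertible n (+ (suc p ℕ.* α))) (invs′ : Invertible n (+ (suc p ℕ.* β)))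
  where

  -- With q = p + 1, the height `M` is qβ + (q - 1)β = (2q - 1)β.
  s s′ M : ℕ
  s  = suc p ℕ.* α
  s′ = suc p ℕ.* β
  M  = s′ ℕ.+ p ℕ.* β

  invα : Invertible n (+ α)
  invα = invertible-factorʳ (suc p) α invs

  invβ : Invertible n (+ β)
  invβ = invertible-factorʳ (suc p) β invs′

  -- The summand α(s′ − 1) comes from reflecting ρ′ to s′ − 1 − ρ′, which turns
  -- the differences βρ − αρ′ into sums.
  target : ℤ → ℤ
  target k = + s * + β * k + + α * (+ s′ - 1ℤ)

  Hit : ℤ → Set
  Hit c = ∃₂ λ r h → r ℕ.< α × h ℕ.< M × + n ∣ value α β r (+ h) - c

  -- Write e = r + jα with r < α. The multiple jα is traded for jβ in the other coordinate, and e <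
  -- qα gives j ≤ p.
  flatten : ∀ {e e′} → e ℕ.< s → e′ ℕ.< s′ →
    ∃₂ λ r h → r ℕ.< α × h ℕ.< M × value α β e (+ e′) ≡ value α β r (+ h)
  flatten {e} {e′} e<s e′<s′ = e % α , e′ ℕ.+ j ℕ.* β , ℕ.m%n<n e α ,
    ℕ.+-mono-<-≤ e′<s′ (ℕ.*-monoˡ-≤ β {j} {p} (ℕ.s≤s⁻¹ (ℕ.m<n*o⇒m/o<n {e} {suc p} {α} e<s))) ,
    trans (cong (λ m → + β * m + + α * + e′)
                (trans (cong +_ (ℕ.m≡m%n+[m/n]*n e α)) (cong (λ m → + (e % α) + m) (pos-* j α))))
          (trans (lem (+ α) (+ β) (+ (e % α)) (+ e′) (+ j))
                 (cong (λ m → + β * + (e % α) + + α * (+ e′ + m)) (sym (pos-* j β))))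
    where
    j = e ℕ./ α
    lem : ∀ α β r e′ j → β * (r + j * α) + α * e′ ≡ β * r + α * (e′ + j * β)
    lem = solve-∀

  -- Two trades cover the rectangle: none when h < s′, and the largest one, pβ for pα, when h ≥ s′ ≥
  -- pβ.
  unflatten : ∀ {r h} → r ℕ.< α → h ℕ.< M →
    ∃₂ λ e e′ → e ℕ.< s × e′ ℕ.< s′ × value α β e (+ e′) ≡ value α β r (+ h)
  unflatten {r} {h} r<α h<M with h ℕ.<? s′
  ... | yes h<s′ = r , h , ℕ.<-≤-trans r<α (ℕ.m≤m+n α (p ℕ.* α)) , h<s′ , refl
  ... | no h≮s′ with ℕ.m≤n⇒∃[o]m+o≡n (ℕ.≤-trans (ℕ.m≤n+m (p ℕ.* β) β) (ℕ.≮⇒≥ h≮s′))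
  ... | e′ , refl = r ℕ.+ p ℕ.* α , e′ , ℕ.+-monoˡ-< (p ℕ.* α) r<α ,
    ℕ.+-cancelˡ-< (p ℕ.* β) e′ s′ (subst (p ℕ.* β ℕ.+ e′ ℕ.<_) (ℕ.+-comm s′ (p ℕ.* β)) h<M) ,
    trans (cong (λ m → + β * (+ r + m) + + α * + e′) (pos-* p α))
      (trans (lem (+ α) (+ β) (+ r) (+ e′) (+ p))
             (cong (λ m → + β * + r + + α * (m + + e′)) (sym (pos-* p β))))
    where
    lem : ∀ α β r e′ p → β * (r + p * α) + α * e′ ≡ β * r + α * (p * β + e′)
    lem = solve-∀

  αs′≡sβ : + α * + s′ ≡ + s * + β
  αs′≡sβ = trans (sym (pos-* α s′)) (trans (cong +_ (lem α p β)) (pos-* s β))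
    where
    lem : ∀ α p β → α ℕ.* (suc p ℕ.* β) ≡ suc p ℕ.* α ℕ.* β
    lem = ℕ-Solver.solve-∀

  -- Since βs = αs′, taking β times the first congruence minus α times the second eliminates the
  -- position u and leaves βρ - αρ′ ≡ sβk (mod n).
  ¬Hit⇒Avoid : ∀ k → ¬ Hit (target k) → Avoid n s s′ k
  ¬Hit⇒Avoid k ¬hit u ρ ρ′ ρ<s ρ′<s′ n∣ n∣′ with ℕ.m≤n⇒∃[o]m+o≡n ρ′<s′
  ... | e′ , 1+ρ′+e′≡s′ with flatten ρ<s (ℕ.≤-trans (ℕ.+-monoˡ-≤ e′ (s≤s z≤n)) (ℕ.≤-reflexive 1+ρ′+e′≡s′))
  ... | r , h , r<α , h<M , value≡ = ¬hit (r , h , r<α , h<M , subst (λ v → + n ∣ v - target k) value≡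
    (subst (+ n ∣_) (lem (+ α) (+ β) (+ s) u k (+ ρ) (+ ρ′) (+ e′) αs′≡sβ (cong +_ 1+ρ′+e′≡s′))
      (∣m∣n⇒∣m-n (∣n⇒∣m*n (+ β) n∣) (∣n⇒∣m*n (+ α) n∣′))))
    where
    lem : ∀ α β s {s′} u k ρ ρ′ e′ → α * s′ ≡ s * β → 1ℤ + ρ′ + e′ ≡ s′ →
      β * (u * s + ρ) - α * ((u + k) * s′ + ρ′) ≡ β * ρ + α * e′ - (s * β * k + α * (s′ - 1ℤ))
    lem α β s u k ρ ρ′ e′ eq refl = ≡-from (- (u + k)) eq (move α β s u k ρ ρ′ e′)
      where
      move : ∀ α β s u k ρ ρ′ e′ → β * (u * s + ρ) - α * ((u + k) * (1ℤ + ρ′ + e′) + ρ′)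
          - (β * ρ + α * e′ - (s * β * k + α * (1ℤ + ρ′ + e′ - 1ℤ))) ≡
        (- (u + k)) * (α * (1ℤ + ρ′ + e′) - s * β)
      move = solve-∀

  Avoid⇒¬Hit : ∀ k → Avoid n s s′ k → ¬ Hit (target k)
  Avoid⇒¬Hit k avoid (r , h , r<α , h<M , n∣) with unflatten r<α h<M
  ... | e , e′ , e<s , e′<s′ , value≡ with ℕ.m≤n⇒∃[o]m+o≡n e′<s′
  ... | ρ′ , 1+e′+ρ′≡s′ = avoid u e ρ′ e<s
      (ℕ.≤-trans (ℕ.+-monoˡ-≤ ρ′ (s≤s z≤n)) (ℕ.≤-reflexive 1+e′+ρ′≡s′)) n∣us+e
      -- The elimination run backwards yields α times the second congruence; α is invertible modulo
      -- n.
      (cancel {m = + α} invα _ (subst (+ n ∣_)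
        (lem (+ α) (+ β) (+ s) u k (+ e) (+ e′) (+ ρ′) αs′≡sβ (cong +_ 1+e′+ρ′≡s′))
        (∣m∣n⇒∣m-n (∣n⇒∣m*n (+ β) n∣us+e) (subst (λ v → + n ∣ v - target k) (sym value≡) n∣))))
    where
    -- The solution of us + e ≡ 0 (mod n).
    u = - proj₁ invs * + e
    inverse : ∀ w s e → (w * s - 1ℤ) * (- e) ≡ (- w) * e * s + e
    inverse = solve-∀
    n∣us+e : + n ∣ u * + s + + e
    n∣us+e = subst (+ n ∣_) (inverse (proj₁ invs) (+ s) (+ e)) (∣m⇒∣m*n (- + e) (proj₂ invs))
    lem : ∀ α β s {s′} u k e e′ ρ′ → α * s′ ≡ s * β → 1ℤ + e′ + ρ′ ≡ s′ →
      β * (u * s + e) - (β * e + α * e′ - (s * β * k + α * (s′ - 1ℤ))) ≡ α * ((u + k) * s′ + ρ′)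
    lem α β s u k e e′ ρ′ eq refl = ≡-from (- (u + k)) eq (move α β s u k e e′ ρ′)
      where
      move : ∀ α β s u k e e′ ρ′ →
        β * (u * s + e) - (β * e + α * e′ - (s * β * k + α * (1ℤ + e′ + ρ′ - 1ℤ)))
          - α * ((u + k) * (1ℤ + e′ + ρ′) + ρ′) ≡
        (- (u + k)) * (α * (1ℤ + e′ + ρ′) - s * β)
      move = solve-∀

  target-surjective : ∀ c → ∃[ k ] + n ∣ c - target (+ toℕ {n} k)
  target-surjective c = fromℕ< (n%ℕd<d k₀ n) ,
    subst (λ k → + n ∣ c - target (+ k)) (sym (toℕ-fromℕ< (n%ℕd<d k₀ n)))
      (subst (+ n ∣_) (≡-from (- (+ s * + β)) (a≡a%ℕn+[a/ℕn]*n k₀ n)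
          (move (+ s) (+ β) w w′ c o (+ (k₀ %ℕ n)) (k₀ /ℕ n) (+ n)))
        (∣m∣n⇒∣m+n (∣m∣n⇒∣m+n (∣m⇒∣m*n (- (w′ * + β * (c - o))) (proj₂ invs))
                              (∣m⇒∣m*n (- (c - o)) (proj₂ invβ)))
                   (∣n⇒∣m*n (+ s * + β * (k₀ /ℕ n)) ∣-refl)))
    where
    w w′ o k₀ : ℤ
    w = proj₁ invs
    w′ = proj₁ invβ
    o = + α * (+ s′ - 1ℤ)
    -- The solution of sβk + o ≡ c (mod n), with w and w′ the inverses of s and β; the rotation is
    -- its residue.
    k₀ = w * w′ * (c - o)
    move : ∀ s β w w′ c o k Q n →
      (w * s - 1ℤ) * (- (w′ * β * (c - o))) + (w′ * β - 1ℤ) * (- (c - o)) + s * β * Q * n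
        - (c - (s * β * k + o)) ≡
      (- (s * β)) * (w * w′ * (c - o) - (k + Q * n))
    move = solve-∀

  target-injective : ∀ {k k′ : Fin n} → + n ∣ target (+ toℕ k) - target (+ toℕ k′) → k ≡ k′
  target-injective {k} {k′} n∣ = toℕ-injective (residue-unique (toℕ<n k) (toℕ<n k′)
    (cancel {m = + β} invβ _ (cancel {m = + s} invs _
      (subst (+ n ∣_) (lem (+ s) (+ β) (+ toℕ k) (+ toℕ k′) (+ α * (+ s′ - 1ℤ))) n∣))))
    where
    lem : ∀ s β k k′ o → s * β * k + o - (s * β * k′ + o) ≡ s * (β * (k - k′))
    lem = solve-∀

-- Every residue class meets the L-shape

module Covering
  (n p α β y : ℕ) (x : ℤ) .{{_ : NonZero n}} .{{_ : NonZero α}} .{{_ : NonZero β}}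
  (s≤n : suc p ℕ.* α ℕ.≤ n) (s′≤n : suc p ℕ.* β ℕ.≤ n)
  (invs : Invertible n (+ (suc p ℕ.* α))) (invs′ : Invertible n (+ (suc p ℕ.* β)))
  (y≤α : y ℕ.≤ α)
  (n≡ : + n ≡ + β * + y + + α * (x + + (2 ℕ.* (p ℕ.* β))))
  where

  open Superimposition n p α β s≤n s′≤n invs invs′

  X : ℤ
  X = x + + (2 ℕ.* (p ℕ.* β))

  open Staircase n α β y X n≡ y≤α

  -- The climb starts in row 0, at height c/α modulo n lowered by n to make it negative. The fuel is
  -- the distance of the starting value from αβ.
  reach : ∀ c → ∃₂ λ r h → r ℕ.< α × UnderStep r (+ h) × + n ∣ value α β r (+ h) - c
  reach c with climb ∣ + α * + β - value α β 0 h₀ ∣ 0 h₀ (ℕ.>-nonZero⁻¹ α) h₀<0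
      (≤-from (i≤j⇒0≤j-i (i≤+∣i∣ (+ α * + β - value α β 0 h₀)))
        (fuel-lem (value α β 0 h₀) (+ ∣ + α * + β - value α β 0 h₀ ∣) (+ α * + β)))
    where
    h₀ : ℤ
    h₀ = + ((proj₁ invα * c) %ℕ n) - + n
    h₀<0 : h₀ < 0ℤ
    h₀<0 = <-from (cast< (n%ℕd<d (proj₁ invα * c) n)) (lem (+ ((proj₁ invα * c) %ℕ n)) (+ n))
      where
      lem : ∀ ρ n → n - ρ - 1ℤ ≡ 0ℤ - (ρ - n) - 1ℤ
      lem = solve-∀
    fuel-lem : ∀ v f m → f - (m - v) ≡ v + f - m
    fuel-lem = solve-∀
  ... | r , + h , r<α , _ , under , n∣ = r , h , r<α , under ,
    subst (+ n ∣_) (≡-from (+ α) (a≡a%ℕn+[a/ℕn]*n (proj₁ invα * c) n)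
        (move (value α β r (+ h)) (+ α) (+ β) (proj₁ invα) c
              (+ ((proj₁ invα * c) %ℕ n)) ((proj₁ invα * c) /ℕ n) (+ n)))
      (∣m∣n⇒∣m-n (∣m∣n⇒∣m+n n∣ (∣m⇒∣m*n c (proj₂ invα)))
        (∣n⇒∣m*n (+ α * ((proj₁ invα * c) /ℕ n + 1ℤ)) ∣-refl))
    where
    move : ∀ v α β w c ρ Q n →
      v - (β * + 0 + α * (ρ - n)) + (w * α - 1ℤ) * c - α * (Q + 1ℤ) * n - (v - c) ≡
      α * (w * c - (ρ + Q * n))
    move = solve-∀

  M+x≡ : + M + x ≡ X + + β
  M+x≡ = lem (+ β) (+ (p ℕ.* β)) x
    where
    lem : ∀ β m x → β + m + m + x ≡ x + (m + (m + 0ℤ)) + β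
    lem = solve-∀

  -- Superimposability enters here. For x < 0 both boundary heights X and X + β = M + x lie below M,
  -- so the representative found by `reach` hits every target.
  0≤x : (∃[ k ] Avoid n s s′ k) → 0ℤ ≤ x
  0≤x (k , avoid) with 0ℤ ≤? x
  ... | yes 0≤x = 0≤x
  ... | no 0≰x with reach (target k)
  ... | r , h , r<α , (under , under′) , n∣ =
    contradiction (r , h , r<α , drop‿+<+ (<-trans h<X+β X+β<M) , n∣) (Avoid⇒¬Hit k avoid)
    where
    h<X+β : + h < X + + β
    h<X+β with r ℕ.<? y
    ... | yes r<y = under r<y
    ... | no r≮y = <-≤-trans (under′ (ℕ.≮⇒≥ r≮y)) (≤-from (0≤+ {β}) (lem X (+ β)))
      where
      lem : ∀ X β → β ≡ X + β - X
      lem = solve-∀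
    X+β<M : X + + β < + M
    X+β<M = subst (_< + M) M+x≡ (subst (+ M + x <_) (+-identityʳ (+ M)) (+-monoʳ-< (+ M) (≰⇒> 0≰x)))

-- Counting the missed residues

module _
  (n p α β y x : ℕ) .{{_ : NonZero n}} .{{_ : NonZero α}} .{{_ : NonZero β}}
  (s≤n : suc p ℕ.* α ℕ.≤ n) (s′≤n : suc p ℕ.* β ℕ.≤ n)
  (invs : Invertible n (+ (suc p ℕ.* α))) (invs′ : Invertible n (+ (suc p ℕ.* β)))
  (coprime : Invertible α (+ β))
  (y≤α : y ℕ.≤ α)
  (n≡ : + n ≡ + β * + y + + α * (+ x + + (2 ℕ.* (p ℕ.* β))))
  where

  open Superimposition n p α β s≤n s′≤n invs invs′
  open Covering n p α β y (+ x) s≤n s′≤n invs invs′ y≤α n≡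
  open Staircase n α β y X n≡ y≤α

  private instance
    s≢0 : NonZero s
    s≢0 = ℕ.m*n≢0 (suc p) α
    s′≢0 : NonZero s′
    s′≢0 = ℕ.m*n≢0 (suc p) β

  -- Rows below y end at X + β = M + x, the others at X = M + x - β. Truncated subtraction empties
  -- `upper` when x ≤ β, which lets one count serve both cases of the formula.
  lower upper : List (ℕ × ℕ)
  lower = cartesianProduct (upTo y) (applyUpTo (M ℕ.+_) x)
  upper = cartesianProduct (applyUpTo (y ℕ.+_) (α ∸ y)) (applyUpTo (M ℕ.+_) (x ∸ β))

  missed : List (ℕ × ℕ)
  missed = lower ++ upper

  Missed : ℕ × ℕ → Set
  Missed (r , h) = r ℕ.< α × M ℕ.≤ h × UnderStep r (+ h)

  ∈-missed⁺ : ∀ {rh} → Missed rh → rh ∈ missed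
  ∈-missed⁺ {r , h} (r<α , M≤h , under , under′) with r ℕ.<? y | ℕ.m≤n⇒∃[o]m+o≡n M≤h
  ... | yes r<y | o , refl = ∈-++⁺ˡ (∈-cartesianProduct⁺ (∈-upTo⁺ r<y) (∈-applyUpTo⁺ (M ℕ.+_)
          (ℕ.+-cancelˡ-< M o x (drop‿+<+ (subst (+ (M ℕ.+ o) <_) (sym M+x≡) (under r<y))))))
  ... | no r≮y  | o , refl with ℕ.m≤n⇒∃[o]m+o≡n (ℕ.≮⇒≥ r≮y)
  ... | u , refl = ∈-++⁺ʳ lower (∈-cartesianProduct⁺
          (∈-applyUpTo⁺ (y ℕ.+_) (ℕ.m+n≤o⇒m≤o∸n (suc u) (subst (ℕ._≤ α) (cong suc (ℕ.+-comm y u)) r<α)))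
          (∈-applyUpTo⁺ (M ℕ.+_) (ℕ.m+n≤o⇒m≤o∸n (suc o) (ℕ.+-cancelˡ-< M (o ℕ.+ β) x
            (drop‿+<+ (subst₂ _<_ (cong +_ (ℕ.+-assoc M o β)) (sym M+x≡) (+-monoˡ-< (+ β) (under′ (ℕ.≮⇒≥ r≮y)))))))))

  ∈-missed⁻ : ∀ {rh} → rh ∈ missed → Missed rh
  ∈-missed⁻ {r , h} rh∈ with ∈-++⁻ lower rh∈
  ... | inj₁ rh∈lower with ∈-cartesianProduct⁻ (upTo y) _ rh∈lower
  ... | r∈ , h∈ with ∈-applyUpTo⁻ (M ℕ.+_) h∈
  ... | o , o<x , refl = ℕ.<-≤-trans (∈-upTo⁻ r∈) y≤α , ℕ.m≤m+n M o ,
    (λ _ → subst (+ (M ℕ.+ o) <_) M+x≡ (+<+ (ℕ.+-monoʳ-< M o<x))) ,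
    (λ y≤r → contradiction (∈-upTo⁻ r∈) (ℕ.≤⇒≯ y≤r))
  ∈-missed⁻ {r , h} rh∈ | inj₂ rh∈upper
    with ∈-cartesianProduct⁻ (applyUpTo (y ℕ.+_) (α ∸ y)) _ rh∈upper
  ... | r∈ , h∈ with ∈-applyUpTo⁻ (y ℕ.+_) r∈ | ∈-applyUpTo⁻ (M ℕ.+_) h∈
  ... | u , u<α∸y , refl | o , o<x∸β , refl =
    subst (y ℕ.+ u ℕ.<_) (ℕ.m+[n∸m]≡n y≤α) (ℕ.+-monoʳ-< y u<α∸y) , ℕ.m≤m+n M o ,
    (λ y+u<y → contradiction y+u<y (ℕ.≤⇒≯ (ℕ.m≤m+n y u))) ,
    (λ _ → <-from (<⇒gap (subst (+ (M ℕ.+ o ℕ.+ β) <_) M+x≡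
             (+<+ (subst (ℕ._< M ℕ.+ x) (sym (ℕ.+-assoc M o β)) (ℕ.+-monoʳ-< M (<∸⇒+< o<x∸β))))))
             (lem (+ (M ℕ.+ o)) X (+ β)))
    where
    <∸⇒+< : ∀ {i j k} → i ℕ.< j ∸ k → i ℕ.+ k ℕ.< j
    <∸⇒+< {i} {j} {k} i<j∸k = ℕ.≰⇒> λ j≤i+k → ℕ.<⇒≱ i<j∸k
      (ℕ.m≤n+o⇒m∸n≤o j k (subst (j ℕ.≤_) (ℕ.+-comm i k) j≤i+k))
    lem : ∀ h X β → X + β - (h + β) - 1ℤ ≡ X - h - 1ℤ
    lem = solve-∀

  missed-unique : Unique missed
  missed-unique = Unique.++⁺
    (Unique.cartesianProduct⁺ (Unique.upTo⁺ y) (interval M x))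
    (Unique.cartesianProduct⁺ (interval y (α ∸ y)) (interval M (x ∸ β)))
    λ { {r , h} (∈lower , ∈upper) →
        let r∈ , _  = ∈-cartesianProduct⁻ (upTo y) _ ∈lower
            r∈′ , _ = ∈-cartesianProduct⁻ (applyUpTo (y ℕ.+_) (α ∸ y)) _ ∈upper
            u , _ , r≡ = ∈-applyUpTo⁻ (y ℕ.+_) r∈′
        in ℕ.<⇒≱ (∈-upTo⁻ r∈) (subst (y ℕ.≤_) (sym r≡) (ℕ.m≤m+n y u)) }
    where
    interval : ∀ m k → Unique (applyUpTo (m ℕ.+_) k)
    interval m k = Unique.applyUpTo⁺₁ (m ℕ.+_) k λ i<j _ eq → ℕ.<⇒≢ i<j (ℕ.+-cancelˡ-≡ m _ _ eq)

  length-missed : length missed ≡ y ℕ.* x ℕ.+ (α ∸ y) ℕ.* (x ∸ β)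
  length-missed = trans (length-++ lower) (cong₂ ℕ._+_
    (trans (length-cartesianProduct (upTo y) _) (cong₂ ℕ._*_ (length-upTo y) (length-applyUpTo _ x)))
    (trans (length-cartesianProduct (applyUpTo (y ℕ.+_) (α ∸ y)) _)
           (cong₂ ℕ._*_ (length-applyUpTo _ (α ∸ y)) (length-applyUpTo _ (x ∸ β)))))

  u : Vec AZ n
  u = C a z n s
  v : Vec BZ n
  v = C b z n s′

  Superimposed? : Decidable (λ k → PerfectlySuperimposable u (γ^ (toℕ k) v))
  Superimposed? k = perfectlySuperimposable? u (γ^ (toℕ {n} k) v)

  superimpositions : List (Fin n)
  superimpositions = filter Superimposed? (List.allFin n)

  Represents : Fin n → ℕ × ℕ → Set
  Represents k (r , h) = + n ∣ value α β r (+ h) - target (+ toℕ k)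

  -- The L-shape contains a representative of the target; at a height below `M` it would be a hit.
  superimposition⇒missed : ∀ {k} → k ∈ superimpositions → ∃[ rh ] rh ∈ missed × Represents k rh
  superimposition⇒missed {k} k∈ with reach (target (+ toℕ k))
  ... | r , h , r<α , under , n∣ = (r , h) , ∈-missed⁺ (r<α , M≤h , under) , n∣
    where
    avoid : Avoid n s s′ (+ toℕ k)
    avoid = to (perfectlySuperimposable⇔Avoid n s s′ s≤n s′≤n (toℕ k))
               (proj₂ (∈-filter⁻ Superimposed? {xs = List.allFin n} k∈))
    M≤h : M ℕ.≤ h
    M≤h = ℕ.≮⇒≥ λ h<M → Avoid⇒¬Hit (+ toℕ k) avoid (r , h , r<α , h<M , n∣)

  same-target : ∀ {r h r′ h′} k → Represents k (r , h) → Represents k (r′ , h′) →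
    + n ∣ value α β r′ (+ h′) - value α β r (+ h)
  same-target {r} {h} {r′} {h′} k n∣ n∣′ =
    subst (+ n ∣_) (lem (value α β r′ (+ h′)) (value α β r (+ h)) (target (+ toℕ k))) (∣m∣n⇒∣m-n n∣′ n∣)
    where
    lem : ∀ i j k → i - k - (j - k) ≡ i - j
    lem = solve-∀

  same-value : ∀ {k k′} rh → Represents k rh → Represents k′ rh → k ≡ k′
  same-value {k} {k′} (r , h) n∣ n∣′ = target-injective
    (subst (+ n ∣_) (lem (value α β r (+ h)) (target (+ toℕ k)) (target (+ toℕ k′))) (∣m∣n⇒∣m-n n∣′ n∣))
    where
    lem : ∀ i j k → i - k - (i - j) ≡ j - k
    lem = solve-∀

  0≤X : 0ℤ ≤ X
  0≤X = 0≤+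

  -- A hit would be a point of the same class at height h′ < M ≤ h, whereas `lowest` gives h ≤ h′.
  missed⇒¬Hit : ∀ {r h} → Missed (r , h) → ∃[ k ] ¬ Hit (target (+ toℕ k)) × Represents k (r , h)
  missed⇒¬Hit {r} {h} (r<α , M≤h , under) = k , ¬hit , n∣
    where
    k : Fin n
    k = proj₁ (target-surjective (value α β r (+ h)))
    n∣ : Represents k (r , h)
    n∣ = proj₂ (target-surjective (value α β r (+ h)))
    ¬hit : ¬ Hit (target (+ toℕ k))
    ¬hit (r′ , h′ , r′<α , h′<M , n∣′) = ℕ.<⇒≱ h′<M (ℕ.≤-trans M≤h
      (drop‿+≤+ (lowest coprime 0≤X r<α r′<α under 0≤+ (same-target k n∣ n∣′))))

  missed⇒superimposition : ∀ {rh} → rh ∈ missed → ∃[ k ] k ∈ superimpositions × Represents k rh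
  missed⇒superimposition rh∈ =
    let k , ¬hit , n∣ = missed⇒¬Hit (∈-missed⁻ rh∈)
    in k , ∈-filter⁺ Superimposed? (∈-allFin k)
             (from (perfectlySuperimposable⇔Avoid n s s′ s≤n s′≤n (toℕ k)) (¬Hit⇒Avoid (+ toℕ k) ¬hit)) , n∣

  represented-lowest : ∀ {r h r′ h′ k} → Missed (r , h) → Missed (r′ , h′) →
    Represents k (r , h) → Represents k (r′ , h′) → h ℕ.≤ h′
  represented-lowest {k = k} (r<α , _ , under) (r′<α , _) n∣ n∣′ =
    drop‿+≤+ (lowest coprime 0≤X r<α r′<α under 0≤+ (same-target k n∣ n∣′))

  same-height⇒same-row : ∀ {r r′ h k} → r ℕ.< α → r′ ℕ.< α →
    Represents k (r , h) → Represents k (r′ , h) → r ≡ r′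
  same-height⇒same-row {r} {r′} {h} {k} r<α r′<α n∣ n∣′ =
    residue-unique (ℕ.<-≤-trans r<α α≤n) (ℕ.<-≤-trans r′<α α≤n)
      (cancel {m = + β} invβ (+ r - + r′)
        (subst (+ n ∣_) (lem (+ β) (+ r) (+ r′) (+ α * + h)) (same-target k n∣′ n∣)))
    where
    α≤n : α ℕ.≤ n
    α≤n = ℕ.≤-trans (ℕ.m≤m+n α (p ℕ.* α)) s≤n
    lem : ∀ β r r′ o → β * r + o - (β * r′ + o) ≡ β * (r - r′)
    lem = solve-∀

  -- Each of the two points is lowest in the class, so the heights agree. Then n divides β(r - r′),
  -- and r, r′ < α ≤ n forces equal rows.
  represents-injective : ∀ {r h r′ h′ k} → Missed (r , h) → Missed (r′ , h′) →
    Represents k (r , h) → Represents k (r′ , h′) → (r , h) ≡ (r′ , h′)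
  represents-injective {r} {h} {r′} {h′} {k} m m′ n∣ n∣′ = cong₂ _,_
    (same-height⇒same-row {k = k} (proj₁ m) (proj₁ m′) n∣
      (subst (λ h → Represents k (r′ , h)) (sym h≡h′) n∣′))
    h≡h′
    where
    h≡h′ : h ≡ h′
    h≡h′ = ℕ.≤-antisym (represented-lowest {k = k} m m′ n∣ n∣′) (represented-lowest {k = k} m′ m n∣′ n∣)

  numberOfSuperimpositions≡ :
    numberOfSuperimpositions u v ≡ y ℕ.* x ℕ.+ (α ∸ y) ℕ.* (x ∸ β)
  numberOfSuperimpositions≡ = trans (count-tabulate Superimposed? id) (trans (ℕ.≤-antisym
    -- One bound rests on the injectivity of `target` modulo n, the other on the uniqueness of
    -- representatives in the L-shape.
    (length-≤ Represents (Unique.filter⁺ Superimposed? (Unique.allFin⁺ n)) superimposition⇒missed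
      (λ {_} {_} {rh} _ _ → same-value rh))
    (length-≤ (λ rh k → Represents k rh) missed-unique missed⇒superimposition
      (λ {_} {_} {k} rh∈ rh′∈ → represents-injective {k = k} (∈-missed⁻ rh∈) (∈-missed⁻ rh′∈))))
    length-missed)

-- The two cases of the formula

length-equation : ∀ n p α β x y →
  x * + α + + y * + β ≡ + n - + 2 * + α * + β * (+ suc p - + 1) →
  + n ≡ + β * + y + + α * (x + + (2 *ℕ (p *ℕ β)))
length-equation n p α β x y eq =
  ≡-from (- 1ℤ) eq (trans
    (cong (λ m → + n - (+ β * + y + + α * (x + (m + (m + 0ℤ))))) (pos-* p β))
    (move (+ n) (+ p) (+ α) (+ β) x (+ y)))
  where
  move : ∀ n p α β x y → n - (β * y + α * (x + (p * β + (p * β + 0ℤ)))) ≡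
    (- 1ℤ) * (x * α + y * β - (n - + 2 * α * β * (1ℤ + p - 1ℤ)))
  move = solve-∀

proposition3p31 : (n q α β : ℕ) .{{_ : NonZero n}} .{{_ : NonZero q}} .{{_ : NonZero α}} .{{_ : NonZero β}} →
    gcd α β ≡ 1 →
    q *ℕ α ≤ℕ n → gcd n (q *ℕ α) ≡ 1 →
    q *ℕ β ≤ℕ n → gcd n (q *ℕ β) ≡ 1 →
    Superimposable (C a z n (q *ℕ α)) (C b z n (q *ℕ β)) →
    (x y : ℤ) →
    x * + α + y * + β ≡ + n - + 2 * + α * + β * (+ q - + 1) →
    + 1 ≤ y → y ≤ + α →
    (x ≤ + β →
    + numberOfSuperimpositions (C a z n (q *ℕ α)) (C b z n (q *ℕ β)) ≡ x * y)
    ×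
    (+ β < x →
    + numberOfSuperimpositions (C a z n (q *ℕ α)) (C b z n (q *ℕ β)) ≡
    x * + α + y * + β - + α * + β)
proposition3p31 n zero α β _ _ _ _ _ _ _ _ _ _ _ = contradiction (ℕ.>-nonZero⁻¹ 0) λ ()
proposition3p31 n (suc p) α β gcdαβ s≤n gcdns s′≤n gcdns′ superimposable x (+ y) eq _ (+≤+ y≤α) =
  -- Nonnegativity comes first, so that x can be treated as a natural number in the count.
  result x n≡ (Covering.0≤x n p α β y x s≤n s′≤n invs invs′ y≤α n≡
    (superimposable⇒Avoid n (suc p *ℕ α) (suc p *ℕ β)
      {{it}} {{ℕ.m*n≢0 (suc p) α}} {{ℕ.m*n≢0 (suc p) β}} s≤n s′≤n superimposable))
  where
  invs  = gcd≡1⇒invertible n (suc p *ℕ α) gcdns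
  invs′ = gcd≡1⇒invertible n (suc p *ℕ β) gcdns′
  n≡ = length-equation n p α β x y eq
  N = numberOfSuperimpositions (C a z n (suc p *ℕ α)) (C b z n (suc p *ℕ β))
  result : ∀ x → + n ≡ + β * + y + + α * (x + + (2 *ℕ (p *ℕ β))) → 0ℤ ≤ x →
    (x ≤ + β → + N ≡ x * + y) × (+ β < x → + N ≡ x * + α + + y * + β - + α * + β)
  result (+ x) n≡ _ = low , high
    where
    N≡ : N ≡ y *ℕ x ℕ.+ (α ∸ y) *ℕ (x ∸ β)
    N≡ = numberOfSuperimpositions≡ n p α β y x s≤n s′≤n invs invs′ (gcd≡1⇒invertible α β gcdαβ) y≤α n≡
    low : + x ≤ + β → + N ≡ + x * + y
    low (+≤+ x≤β) = trans (cong +_ (begin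
      N                                   ≡⟨ N≡ ⟩
      y *ℕ x ℕ.+ (α ∸ y) *ℕ (x ∸ β)       ≡⟨ cong (λ o → y *ℕ x ℕ.+ (α ∸ y) *ℕ o) (ℕ.m≤n⇒m∸n≡0 x≤β) ⟩
      y *ℕ x ℕ.+ (α ∸ y) *ℕ 0             ≡⟨ cong (y *ℕ x ℕ.+_) (ℕ.*-zeroʳ (α ∸ y)) ⟩
      y *ℕ x ℕ.+ 0                        ≡⟨ ℕ.+-identityʳ _ ⟩
      y *ℕ x                              ≡⟨ ℕ.*-comm y x ⟩
      x *ℕ y                              ∎)) (pos-* x y)
      where open ≡-Reasoning
    high : + β < + x → + N ≡ + x * + α + + y * + β - + α * + β
    high (+<+ β<x) = trans (cong +_ N≡)
      (trans (cong₂ _+_ (pos-* y x) (pos-* (α ∸ y) (x ∸ β)))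
        (lem (+ α) (+ β) (+ x) (+ y) (+ (α ∸ y)) (+ (x ∸ β))
          (cong +_ (ℕ.m+[n∸m]≡n y≤α)) (cong +_ (ℕ.m+[n∸m]≡n (ℕ.<⇒≤ β<x)))))
      where
      expand : ∀ β y u o → y * (β + o) + u * o ≡ (β + o) * (y + u) + y * β - (y + u) * β
      expand = solve-∀
      -- Naming the differences u = α - y and o = x - β removes the truncated subtractions.
      lem : ∀ α β x y u o → y + u ≡ α → β + o ≡ x → y * x + u * o ≡ x * α + y * β - α * β
      lem α β x y u o refl refl = expand β y u o
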